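{- Let $(t_j^i)_{0\le j\le i}$ be real numbers and let $h_{j,k}^i$ ($0\le k\le i$, $0\le j\le i-k$) be defined by $h_{j,0}^i=t_j^i$ and $h_{j,k}^i=h_{j,k-1}^{i-1}+h_{j,k-1}^{i}+h_{j+1,k-1}^{i}$ for $k\ge 1$. Suppose that there is a constant $c$ with $t_0^i=c$ for all $i\ge 0$, and that Pascal's rule $t^i_{j}=t^{i-1}_{j-1}+t^{i-1}_{j}$ holds for all $i\ge 2$, $1\le j\le i-1$. Fix $j,k\ge 0$ and let $m=j+k+1$. Then the sequence $\{h_{j,k}^{i}\}_{i=j+k}^{\infty}$ satisfies the $m$-th order homogeneous linear recurrence $$\sum_{\ell=0}^{m}(-1)^{\ell}\binom{m}{\ell} h_{j,k}^{i+\ell}=0\qquad\text{for all } i\geq j+k.$$ -}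

module Defs where

open import Algebra.Bundles using (CommutativeRing)
open import Data.Nat as ℕ using (ℕ; zero; suc)
import Data.Nat.Properties as ℕ
open import Data.Product using (∃; _×_; _,_)
open import Data.Rational as ℚ using (ℚ; 0ℚ; 1ℚ; ½; ∣_∣; 1/_; Positive; positive; nonNegative)
import Data.Rational.Properties as ℚ
open import Data.Rational.Solver using (module +-*-Solver)
open import Level using (0ℓ)
open import Relation.Binary.PropositionalEquality as ≡ using (_≡_; refl; cong; subst)

-- The real numbers, as Cauchy sequences of rationals; two reals are equal
-- (_≈_ below) when the difference of the sequences tends to 0.

record ℝ : Set where
  no-eta-equality
  field
    seq    : ℕ → ℚ
    cauchy : ∀ ε → 0ℚ ℚ.< ε → ∃ λ N → ∀ m n → N ℕ.≤ m → N ℕ.≤ n → ∣ seq m ℚ.- seq n ∣ ℚ.< ε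

open ℝ public

infix 4 _≈_

record _≈_ (x y : ℝ) : Set where
  no-eta-equality
  constructor mk≈
  field
    close : ∀ ε → 0ℚ ℚ.< ε → ∃ λ N → ∀ n → N ℕ.≤ n → ∣ seq x n ℚ.- seq y n ∣ ℚ.< ε

open _≈_ public

private

  half>0 : ∀ {ε} → 0ℚ ℚ.< ε → 0ℚ ℚ.< ½ ℚ.* ε
  half>0 {ε} p = ℚ.positive⁻¹ _ {{ℚ.pos*pos⇒pos ½ ε {{positive p}}}}

  halves : ∀ ε → ½ ℚ.* ε ℚ.+ ½ ℚ.* ε ≡ ε
  halves = solve 1 (λ e → con ½ :* e :+ con ½ :* e := e) refl
    where open +-*-Solver

  ∣0∣<ε : ∀ p {ε} → p ≡ 0ℚ → 0ℚ ℚ.< ε → ∣ p ∣ ℚ.< ε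
  ∣0∣<ε _ refl q = q

  ∣p-q∣≡∣q-p∣ : ∀ p q → ∣ p ℚ.- q ∣ ≡ ∣ q ℚ.- p ∣
  ∣p-q∣≡∣q-p∣ p q = ≡.trans (≡.sym (ℚ.∣-p∣≡∣p∣ (p ℚ.- q)))
    (cong ∣_∣ (solve 2 (λ a b → :- (a :- b) := b :- a) refl p q))
    where open +-*-Solver

  ∣a+b∣<ε : ∀ c a b {ε} → c ≡ a ℚ.+ b → ∣ a ∣ ℚ.< ½ ℚ.* ε → ∣ b ∣ ℚ.< ½ ℚ.* ε → ∣ c ∣ ℚ.< ε
  ∣a+b∣<ε c a b {ε} c≡a+b p q = begin-strict
    ∣ c ∣                  ≡⟨ cong ∣_∣ c≡a+b ⟩
    ∣ a ℚ.+ b ∣            ≤⟨ ℚ.∣p+q∣≤∣p∣+∣q∣ a b ⟩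
    ∣ a ∣ ℚ.+ ∣ b ∣        <⟨ ℚ.+-mono-< {∣ a ∣} {½ ℚ.* ε} {∣ b ∣} {½ ℚ.* ε} p q ⟩
    ½ ℚ.* ε ℚ.+ ½ ℚ.* ε    ≡⟨ halves ε ⟩
    ε                      ∎
    where open ℚ.≤-Reasoning

  m⊔n≤o⇒m≤o×n≤o : ∀ m n {o} → m ℕ.⊔ n ℕ.≤ o → m ℕ.≤ o × n ℕ.≤ o
  m⊔n≤o⇒m≤o×n≤o m n p = ℕ.≤-trans (ℕ.m≤m⊔n m n) p , ℕ.≤-trans (ℕ.m≤n⊔m m n) p

  +-diff : ∀ a b c d → (a ℚ.+ b) ℚ.- (c ℚ.+ d) ≡ (a ℚ.- c) ℚ.+ (b ℚ.- d)
  +-diff = solve 4 (λ a b c d → (a :+ b) :- (c :+ d) := (a :- c) :+ (b :- d)) refl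
    where open +-*-Solver

  *-diff : ∀ a b c d → (a ℚ.* b) ℚ.- (c ℚ.* d) ≡ a ℚ.* (b ℚ.- d) ℚ.+ d ℚ.* (a ℚ.- c)
  *-diff = solve 4 (λ a b c d → (a :* b) :- (c :* d) := a :* (b :- d) :+ d :* (a :- c)) refl
    where open +-*-Solver

  neg-diff : ∀ a b → (ℚ.- a) ℚ.- (ℚ.- b) ≡ b ℚ.- a
  neg-diff = solve 2 (λ a b → (:- a) :- (:- b) := b :- a) refl
    where open +-*-Solver

  bounded : ∀ x → ∃ λ B → 0ℚ ℚ.< B × ∃ λ N → ∀ n → N ℕ.≤ n → ∣ seq x n ∣ ℚ.≤ B
  bounded x = let (N , p) = cauchy x 1ℚ (ℚ.positive⁻¹ 1ℚ) in ∣ seq x N ∣ ℚ.+ 1ℚ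
    , ℚ.+-mono-≤-< (ℚ.0≤∣p∣ (seq x N)) (ℚ.positive⁻¹ 1ℚ)
    , N , λ n N≤n → bound (seq x N) (seq x n) (p n N N≤n ℕ.≤-refl)
    where
    split : ∀ a b → a ℚ.+ (b ℚ.- a) ≡ b
    split = solve 2 (λ a b → a :+ (b :- a) := b) refl
      where open +-*-Solver
    bound : ∀ a b → ∣ b ℚ.- a ∣ ℚ.< 1ℚ → ∣ b ∣ ℚ.≤ ∣ a ∣ ℚ.+ 1ℚ
    bound a b r = begin
      ∣ b ∣                   ≡⟨ cong ∣_∣ (split a b) ⟨
      ∣ a ℚ.+ (b ℚ.- a) ∣     ≤⟨ ℚ.∣p+q∣≤∣p∣+∣q∣ a (b ℚ.- a) ⟩
      ∣ a ∣ ℚ.+ ∣ b ℚ.- a ∣   ≤⟨ ℚ.+-monoʳ-≤ ∣ a ∣ (ℚ.<⇒≤ r) ⟩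
      ∣ a ∣ ℚ.+ 1ℚ            ∎
      where open ℚ.≤-Reasoning

  ∣p*q∣<Dδ : ∀ D {δ} p q → 0ℚ ℚ.< D → ∣ p ∣ ℚ.≤ D → ∣ q ∣ ℚ.< δ → ∣ p ℚ.* q ∣ ℚ.< D ℚ.* δ
  ∣p*q∣<Dδ D {δ} p q D>0 p≤D q<δ = begin-strict
    ∣ p ℚ.* q ∣        ≡⟨ ℚ.∣p*q∣≡∣p∣*∣q∣ p q ⟩
    ∣ p ∣ ℚ.* ∣ q ∣    ≤⟨ ℚ.*-monoʳ-≤-nonNeg ∣ q ∣ {{nonNegative (ℚ.0≤∣p∣ q)}} p≤D ⟩
    D ℚ.* ∣ q ∣        <⟨ ℚ.*-monoʳ-<-pos D {{positive D>0}} q<δ ⟩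
    D ℚ.* δ            ∎
    where open ℚ.≤-Reasoning

  divide : ∀ S {ε} → 0ℚ ℚ.< S → 0ℚ ℚ.< ε → ∃ λ δ → 0ℚ ℚ.< δ × S ℚ.* δ ≡ ε
  divide S {ε} S>0 ε>0 = 1/ S ℚ.* ε
    , ℚ.positive⁻¹ _ {{ℚ.pos*pos⇒pos (1/ S) {{ℚ.1/pos⇒pos S}} ε {{positive ε>0}}}}
    , ≡.trans (≡.sym (ℚ.*-assoc S (1/ S) ε))
        (≡.trans (cong (ℚ._* ε) (ℚ.*-inverseʳ S)) (ℚ.*-identityˡ ε))
    where
    instance
      S-pos : Positive S
      S-pos = positive S>0
      S-nonZero : ℚ.NonZero S
      S-nonZero = ℚ.pos⇒nonZero S

  *-close : ∀ {B C ε} → 0ℚ ℚ.< B → 0ℚ ℚ.< C → 0ℚ ℚ.< ε → ∃ λ δ → 0ℚ ℚ.< δ ×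
    (∀ a b c d → ∣ a ∣ ℚ.≤ B → ∣ d ∣ ℚ.≤ C → ∣ a ℚ.- c ∣ ℚ.< δ → ∣ b ℚ.- d ∣ ℚ.< δ →
      ∣ a ℚ.* b ℚ.- c ℚ.* d ∣ ℚ.< ε)
  *-close {B} {C} {ε} B>0 C>0 ε>0 = let
      (δ , δ>0 , Sδ≡ε) = divide (B ℚ.+ C) (ℚ.+-mono-< B>0 C>0) ε>0
    in δ , δ>0 , λ a b c d a≤B d≤C ac bd → begin-strict
    ∣ a ℚ.* b ℚ.- c ℚ.* d ∣                              ≡⟨ cong ∣_∣ (*-diff a b c d) ⟩
    ∣ a ℚ.* (b ℚ.- d) ℚ.+ d ℚ.* (a ℚ.- c) ∣              ≤⟨ ℚ.∣p+q∣≤∣p∣+∣q∣ (a ℚ.* (b ℚ.- d)) (d ℚ.* (a ℚ.- c)) ⟩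
    ∣ a ℚ.* (b ℚ.- d) ∣ ℚ.+ ∣ d ℚ.* (a ℚ.- c) ∣          <⟨ ℚ.+-mono-< {∣ a ℚ.* (b ℚ.- d) ∣} {B ℚ.* δ} {∣ d ℚ.* (a ℚ.- c) ∣} {C ℚ.* δ} (∣p*q∣<Dδ B a (b ℚ.- d) B>0 a≤B bd) (∣p*q∣<Dδ C d (a ℚ.- c) C>0 d≤C ac) ⟩
    B ℚ.* δ ℚ.+ C ℚ.* δ                                  ≡⟨ ℚ.*-distribʳ-+ δ B C ⟨
    (B ℚ.+ C) ℚ.* δ                                      ≡⟨ Sδ≡ε ⟩
    ε                                                    ∎
    where open ℚ.≤-Reasoning

  pointwise : ∀ {x y} → (∀ n → seq x n ≡ seq y n) → x ≈ y
  pointwise {x} {y} eq = mk≈ λ ε ε>0 → 0 , λ n _ →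
    ∣0∣<ε (seq x n ℚ.- seq y n) (≡.trans (cong (ℚ._- seq y n) (eq n)) (ℚ.+-inverseʳ (seq y n))) ε>0

fromℚ : ℚ → ℝ
fromℚ q .seq _ = q
fromℚ q .cauchy ε ε>0 = 0 , λ _ _ _ _ → ∣0∣<ε (q ℚ.- q) (ℚ.+-inverseʳ q) ε>0

infixl 6 _+_
infixl 7 _*_
infix  8 -_

_+_ : ℝ → ℝ → ℝ
(x + y) .seq n = seq x n ℚ.+ seq y n
(x + y) .cauchy ε ε>0 = let
      (M , p) = cauchy x _ (half>0 ε>0)
      (N , q) = cauchy y _ (half>0 ε>0)
    in M ℕ.⊔ N , λ m n m≥ n≥ →
    let (Mm , Nm) = m⊔n≤o⇒m≤o×n≤o M N m≥
        (Mn , Nn) = m⊔n≤o⇒m≤o×n≤o M N n≥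
    in ∣a+b∣<ε ((seq x m ℚ.+ seq y m) ℚ.- (seq x n ℚ.+ seq y n))
         (seq x m ℚ.- seq x n) (seq y m ℚ.- seq y n)
         (+-diff (seq x m) (seq y m) (seq x n) (seq y n)) (p m n Mm Mn) (q m n Nm Nn)

-_ : ℝ → ℝ
(- x) .seq n = ℚ.- seq x n
(- x) .cauchy ε ε>0 = let (N , p) = cauchy x ε ε>0 in
  N , λ m n m≥ n≥ → subst (λ z → ∣ z ∣ ℚ.< ε) (≡.sym (neg-diff (seq x m) (seq x n))) (p n m n≥ m≥)

_*_ : ℝ → ℝ → ℝ
(x * y) .seq n = seq x n ℚ.* seq y n
(x * y) .cauchy ε ε>0 = let
      (B , B>0 , M , p) = bounded x
      (C , C>0 , N , q) = bounded y
      (δ , δ>0 , r)     = *-close B>0 C>0 ε>0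
      (K , u)           = cauchy x δ δ>0
      (L , v)           = cauchy y δ δ>0
    in (M ℕ.⊔ N) ℕ.⊔ (K ℕ.⊔ L) , λ m n m≥ n≥ →
    let (MNm , KLm) = m⊔n≤o⇒m≤o×n≤o (M ℕ.⊔ N) (K ℕ.⊔ L) m≥
        (MNn , KLn) = m⊔n≤o⇒m≤o×n≤o (M ℕ.⊔ N) (K ℕ.⊔ L) n≥
        (Mm , _)    = m⊔n≤o⇒m≤o×n≤o M N MNm
        (_  , Nn)   = m⊔n≤o⇒m≤o×n≤o M N MNn
        (Km , Lm)   = m⊔n≤o⇒m≤o×n≤o K L KLm
        (Kn , Ln)   = m⊔n≤o⇒m≤o×n≤o K L KLn
    in r (seq x m) (seq y m) (seq x n) (seq y n) (p m Mm) (q n Nn) (u m n Km Kn) (v m n Lm Ln)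

private

  ≈-refl : ∀ {x} → x ≈ x
  ≈-refl = pointwise λ _ → refl

  ≈-sym : ∀ {x y} → x ≈ y → y ≈ x
  ≈-sym {x} {y} e = mk≈ λ ε ε>0 → let (N , p) = close e ε ε>0 in
    N , λ n n≥ → subst (ℚ._< ε) (∣p-q∣≡∣q-p∣ (seq x n) (seq y n)) (p n n≥)

  ≈-trans : ∀ {x y z} → x ≈ y → y ≈ z → x ≈ z
  ≈-trans {x} {y} {z} e f = mk≈ λ ε ε>0 →
    let (M , p) = close e _ (half>0 ε>0)
        (N , q) = close f _ (half>0 ε>0)
    in M ℕ.⊔ N , λ n n≥ → let (Mn , Nn) = m⊔n≤o⇒m≤o×n≤o M N n≥ in
       ∣a+b∣<ε (seq x n ℚ.- seq z n) (seq x n ℚ.- seq y n) (seq y n ℚ.- seq z n)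
         (split (seq x n) (seq y n) (seq z n)) (p n Mn) (q n Nn)
    where
    open +-*-Solver
    split : ∀ a b c → a ℚ.- c ≡ (a ℚ.- b) ℚ.+ (b ℚ.- c)
    split = solve 3 (λ a b c → a :- c := (a :- b) :+ (b :- c)) refl

  +-cong : ∀ {x x′ y y′} → x ≈ x′ → y ≈ y′ → x + y ≈ x′ + y′
  +-cong {x} {x′} {y} {y′} e f = mk≈ λ ε ε>0 →
    let (M , p) = close e _ (half>0 ε>0)
        (N , q) = close f _ (half>0 ε>0)
    in M ℕ.⊔ N , λ n n≥ → let (Mn , Nn) = m⊔n≤o⇒m≤o×n≤o M N n≥ in
       ∣a+b∣<ε ((seq x n ℚ.+ seq y n) ℚ.- (seq x′ n ℚ.+ seq y′ n))
         (seq x n ℚ.- seq x′ n) (seq y n ℚ.- seq y′ n)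
         (+-diff (seq x n) (seq y n) (seq x′ n) (seq y′ n)) (p n Mn) (q n Nn)

  -‿cong : ∀ {x y} → x ≈ y → - x ≈ - y
  -‿cong {x} {y} e = mk≈ λ ε ε>0 → let (N , p) = close (≈-sym e) ε ε>0 in
    N , λ n n≥ → subst (λ z → ∣ z ∣ ℚ.< ε) (≡.sym (neg-diff (seq x n) (seq y n))) (p n n≥)

  *-cong : ∀ {x x′ y y′} → x ≈ x′ → y ≈ y′ → x * y ≈ x′ * y′
  *-cong {x} {x′} {y} {y′} e f = mk≈ c
    where
    c : ∀ ε → 0ℚ ℚ.< ε → ∃ λ N → ∀ n → N ℕ.≤ n → ∣ seq x n ℚ.* seq y n ℚ.- seq x′ n ℚ.* seq y′ n ∣ ℚ.< ε
    c ε ε>0 = let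
        (B , B>0 , M , p) = bounded x
        (C , C>0 , N , q) = bounded y′
        (δ , δ>0 , r)     = *-close B>0 C>0 ε>0
        (K , u)           = close e δ δ>0
        (L , v)           = close f δ δ>0
      in (M ℕ.⊔ N) ℕ.⊔ (K ℕ.⊔ L) , λ n n≥ →
      let (MN , KL) = m⊔n≤o⇒m≤o×n≤o (M ℕ.⊔ N) (K ℕ.⊔ L) n≥
          (Mn , Nn) = m⊔n≤o⇒m≤o×n≤o M N MN
          (Kn , Ln) = m⊔n≤o⇒m≤o×n≤o K L KL
      in r (seq x n) (seq y n) (seq x′ n) (seq y′ n) (p n Mn) (q n Nn) (u n Kn) (v n Ln)

ℝ-commutativeRing : CommutativeRing 0ℓ 0ℓ
ℝ-commutativeRing = record
  { Carrier = ℝ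
  ; _≈_     = _≈_
  ; _+_     = _+_
  ; _*_     = _*_
  ; -_      = -_
  ; 0#      = fromℚ 0ℚ
  ; 1#      = fromℚ 1ℚ
  ; isCommutativeRing = record
    { isRing = record
      { +-isAbelianGroup = record
        { isGroup = record
          { isMonoid = record
            { isSemigroup = record
              { isMagma = record
                { isEquivalence = record { refl = ≈-refl ; sym = ≈-sym ; trans = ≈-trans }
                ; ∙-cong = +-cong
                }
              ; assoc = λ x y z → pointwise λ n → ℚ.+-assoc (seq x n) (seq y n) (seq z n)
              }
            ; identity = (λ x → pointwise λ n → ℚ.+-identityˡ (seq x n))
                       , (λ x → pointwise λ n → ℚ.+-identityʳ (seq x n))
            }
          ; inverse = (λ x → pointwise λ n → ℚ.+-inverseˡ (seq x n))
                    , (λ x → pointwise λ n → ℚ.+-inverseʳ (seq x n))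
          ; ⁻¹-cong = -‿cong
          }
        ; comm = λ x y → pointwise λ n → ℚ.+-comm (seq x n) (seq y n)
        }
      ; *-cong = *-cong
      ; *-assoc = λ x y z → pointwise λ n → ℚ.*-assoc (seq x n) (seq y n) (seq z n)
      ; *-identity = (λ x → pointwise λ n → ℚ.*-identityˡ (seq x n))
                   , (λ x → pointwise λ n → ℚ.*-identityʳ (seq x n))
      ; distrib = (λ x y z → pointwise λ n → ℚ.*-distribˡ-+ (seq x n) (seq y n) (seq z n))
                , (λ x y z → pointwise λ n → ℚ.*-distribʳ-+ (seq x n) (seq y n) (seq z n))
      }
    ; *-comm = λ x y → pointwise λ n → ℚ.*-comm (seq x n) (seq y n)
    }
  }

open CommutativeRing ℝ-commutativeRing public using (0#; 1#)
open import Algebra.Properties.Semiring.Sum (CommutativeRing.semiring ℝ-commutativeRing) public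
  using (sum⁺-syntax)
open import Algebra.Properties.Semiring.Exp (CommutativeRing.semiring ℝ-commutativeRing) public
  using (_^_)

fromℕ : ℕ → ℝ
fromℕ n = n ×ℝ 1#
  where
  open import Algebra.Properties.Semiring.Mult (CommutativeRing.semiring ℝ-commutativeRing)
    renaming (_×_ to _×ℝ_)

-- A triangular array (t i j stands for tⱼⁱ) is a function on all of ℕ × ℕ whose
-- values at j > i are unconstrained.  h t i j k stands for h_{j,k}^i; within the
-- range j + k ≤ i the recursion only reads t i′ j′ with j′ ≤ i′, and i ∸ 1 is
-- only taken at i ≥ 1.
h : (ℕ → ℕ → ℝ) → ℕ → ℕ → ℕ → ℝ
h t i j zero    = t i j
h t i j (suc k) = h t (i ℕ.∸ 1) j k + h t i j k + h t i (suc j) k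

{-# OPTIONS --safe #-}
module Submission where

-- The alternating binomial sum of order m is the m-fold iterate of the
-- difference operator f ↦ (i ↦ f i − f (i + 1)).  Pascal's rule says that this
-- operator sends column j + 1 of t to minus column j, and it kills the constant
-- column 0, so j + 1 differences kill column j.  Each step of the recursion for h
-- adds a shift of the same column, the column itself and the next column, hence
-- costs one more difference.

open import Algebra.Bundles using (CommutativeRing)
open import Data.Fin using (Fin; toℕ)
open import Data.Nat as ℕ using (ℕ; zero; suc; _≤_; _∸_; z≤n; s≤s)
import Data.Nat.Properties as ℕ
open import Data.Nat.Combinatorics using (_C_; nCk+nC[k+1]≡[n+1]C[k+1]; k>n⇒nCk≡0)
open import Relation.Binary.PropositionalEquality as ≡ using (_≡_)

module IteratedDifference {r ℓ} (R : CommutativeRing r ℓ) where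

  open CommutativeRing R
  open import Algebra.Properties.AbelianGroup +-abelianGroup using (xyx⁻¹≈y)
  open import Algebra.Properties.CommutativeSemigroup +-commutativeSemigroup using (interchange)
  open import Algebra.Properties.Ring ring using (-‿+-comm; -1*x≈-x; [y-z]x≈yx-zx)
  open import Algebra.Properties.Semiring.Exp semiring using (_^_)
  open import Algebra.Properties.Semiring.Mult semiring using (×-homo-+) renaming (_×_ to _×ᴿ_)
  open import Algebra.Properties.Semiring.Sum semiring
    using (∑-distrib-+; *-distribˡ-sum; sum-cong-≋; sum-replicate-zero; sum-syntax)
  open import Relation.Binary.Reasoning.Setoid setoid

  -- Subtracting the later value gives `f (i + l)` the coefficient of sign `(-1)^l`, without a
  -- global factor `(-1)^m`.
  diff : ℕ → (ℕ → Carrier) → ℕ → Carrier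
  diff zero    f i = f i
  diff (suc m) f i = diff m f i - diff m f (suc i)

  -- Serves the summand of `h` in row `i ∸ 1`: its differences are those of the column itself, one
  -- row earlier.
  diff-∘suc : ∀ m f i → diff m (λ n → f (suc n)) i ≡ diff m f (suc i)
  diff-∘suc zero    f i = ≡.refl
  diff-∘suc (suc m) f i = ≡.cong₂ _-_ (diff-∘suc m f i) (diff-∘suc m f (suc i))

  diff-distrib-+ : ∀ m f g i → diff m (λ n → f n + g n) i ≈ diff m f i + diff m g i
  diff-distrib-+ zero    f g i = refl
  diff-distrib-+ (suc m) f g i = trans
    (+-cong (diff-distrib-+ m f g i) (-‿cong (diff-distrib-+ m f g (suc i))))
    (trans (+-congˡ (sym (-‿+-comm _ _))) (interchange _ _ _ _))

  -- The bound N is needed because Pascal's rule is assumed only strictly below the diagonal.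
  diff-antidifference : ∀ {N f g} → (∀ i → N ≤ i → f (suc i) ≈ g i + f i) →
    ∀ m i → N ≤ i → diff (suc m) f i ≈ - diff m g i
  diff-antidifference {f = f} {g} step zero i N≤i = begin
    f i - f (suc i)        ≈⟨ +-congˡ (-‿cong (step i N≤i)) ⟩
    f i - (g i + f i)      ≈⟨ +-congˡ (-‿+-comm (g i) (f i)) ⟨
    f i + (- g i - f i)    ≈⟨ +-assoc (f i) (- g i) (- f i) ⟨
    f i - g i - f i        ≈⟨ xyx⁻¹≈y (f i) (- g i) ⟩
    - g i                  ∎
  diff-antidifference {g = g} step (suc m) i N≤i = trans
    (+-cong (diff-antidifference step m i N≤i)
            (-‿cong (diff-antidifference step m (suc i) (ℕ.m≤n⇒m≤1+n N≤i))))
    (-‿+-comm (diff m g i) (- diff m g (suc i)))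

  -- Pointwise, because columns are annihilated only from some row on.
  diff-suc-zero : ∀ m f i → diff m f i ≈ 0# → diff m f (suc i) ≈ 0# → diff (suc m) f i ≈ 0#
  diff-suc-zero m f i p q = trans (+-cong p (-‿cong q)) (-‿inverseʳ 0#)

  coeff : ℕ → ℕ → Carrier
  coeff m l = (- 1#) ^ l * ((m C l) ×ᴿ 1#)

  -- Pascal's rule for binomial coefficients; the extra factor `- 1#` turns its `m C l` half into
  -- the subtraction in `diff`.
  coeff-suc : ∀ m l → coeff (suc m) (suc l) ≈ coeff m (suc l) - coeff m l
  coeff-suc m l = begin
    (- 1#) ^ suc l * ((suc m C suc l) ×ᴿ 1#)
      ≡⟨ ≡.cong (λ n → (- 1#) ^ suc l * (n ×ᴿ 1#)) (nCk+nC[k+1]≡[n+1]C[k+1] m l) ⟨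
    (- 1#) ^ suc l * ((m C l ℕ.+ m C suc l) ×ᴿ 1#)
      ≈⟨ *-congˡ (×-homo-+ 1# (m C l) (m C suc l)) ⟩
    - 1# * (- 1#) ^ l * ((m C l) ×ᴿ 1# + (m C suc l) ×ᴿ 1#)
      ≈⟨ trans (distribˡ _ _ _) (+-comm _ _) ⟩
    coeff m (suc l) + - 1# * (- 1#) ^ l * ((m C l) ×ᴿ 1#)
      ≈⟨ +-congˡ (trans (*-assoc _ _ _) (-1*x≈-x _)) ⟩
    coeff m (suc l) - coeff m l ∎

  -- The summation bound is any N ≥ m: the terms with l > m vanish, and the slack
  -- makes the two halves of Pascal's rule sums of the required form.
  ∑-coeff≈diff : ∀ m N f i → m ≤ N →
    ∑[ l < suc N ] (coeff m (toℕ l) * f (i ℕ.+ toℕ l)) ≈ diff m f i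
  ∑-coeff≈diff zero N f i _ = begin
    coeff 0 0 * f (i ℕ.+ 0) + ∑[ l < N ] (coeff 0 (suc (toℕ l)) * f (i ℕ.+ suc (toℕ l)))
      ≈⟨ +-cong (*-congʳ (trans (*-identityˡ _) (+-identityʳ 1#)))
                (trans (sum-cong-≋ vanish) (sum-replicate-zero N)) ⟩
    1# * f (i ℕ.+ 0) + 0#  ≈⟨ trans (+-identityʳ _) (*-identityˡ _) ⟩
    f (i ℕ.+ 0)            ≡⟨ ≡.cong f (ℕ.+-identityʳ i) ⟩
    f i                    ∎
    where
    vanish : ∀ (l : Fin N) → coeff 0 (suc (toℕ l)) * f (i ℕ.+ suc (toℕ l)) ≈ 0#
    vanish l = begin
      coeff 0 k * x          ≡⟨ ≡.cong (λ n → (- 1#) ^ k * (n ×ᴿ 1#) * x) (k>n⇒nCk≡0 {0} {k} (s≤s z≤n)) ⟩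
      (- 1#) ^ k * 0# * x    ≈⟨ trans (*-congʳ (zeroʳ _)) (zeroˡ x) ⟩
      0#                     ∎
      where
      k : ℕ
      k = suc (toℕ l)
      x : Carrier
      x = f (i ℕ.+ k)
  ∑-coeff≈diff (suc m) (suc N) f i (s≤s m≤N) = begin
    -- `suc m C 0` and `m C 0` both compute to 1, so `head` can already be written with order `m`.
    head + ∑[ l < suc N ] (coeff (suc m) (suc (toℕ l)) * f (i ℕ.+ suc (toℕ l)))
      ≈⟨ +-congˡ (sum-cong-≋ split) ⟩
    head + ∑[ l < suc N ] (u l + - 1# * v l)
      ≈⟨ +-congˡ (∑-distrib-+ u (λ l → - 1# * v l)) ⟩
    head + (∑[ l < suc N ] u l + ∑[ l < suc N ] (- 1# * v l))
      ≈⟨ +-congˡ (+-congˡ (*-distribˡ-sum (- 1#) v)) ⟨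
    head + (∑[ l < suc N ] u l + - 1# * ∑[ l < suc N ] v l)
      ≈⟨ trans (sym (+-assoc _ _ _)) (+-congˡ (-1*x≈-x _)) ⟩
    (head + ∑[ l < suc N ] u l) - ∑[ l < suc N ] v l
      -- `head` supplies the `l = 0` term missing from `u`, so that half has bound `suc N`; the half
      -- in `v` starts at `suc i` and keeps `N`.
      ≈⟨ +-cong (∑-coeff≈diff m (suc N) f i (ℕ.m≤n⇒m≤1+n m≤N))
                (-‿cong (∑-coeff≈diff m N f (suc i) m≤N)) ⟩
    diff m f i - diff m f (suc i) ∎
    where
    head : Carrier
    head = coeff m 0 * f (i ℕ.+ 0)
    u v : Fin (suc N) → Carrier
    u l = coeff m (suc (toℕ l)) * f (i ℕ.+ suc (toℕ l))
    v l = coeff m (toℕ l) * f (suc i ℕ.+ toℕ l)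
    split : ∀ l → coeff (suc m) (suc (toℕ l)) * f (i ℕ.+ suc (toℕ l)) ≈ u l + - 1# * v l
    split l = begin
      coeff (suc m) (suc (toℕ l)) * f (i ℕ.+ suc (toℕ l))
        ≈⟨ *-congʳ (coeff-suc m (toℕ l)) ⟩
      (coeff m (suc (toℕ l)) - coeff m (toℕ l)) * f (i ℕ.+ suc (toℕ l))
        ≈⟨ trans ([y-z]x≈yx-zx _ _ _) (+-congˡ (sym (-1*x≈-x _))) ⟩
      u l + - 1# * (coeff m (toℕ l) * f (i ℕ.+ suc (toℕ l)))
        ≡⟨ ≡.cong (λ n → u l + - 1# * (coeff m (toℕ l) * f n)) (ℕ.+-suc i (toℕ l)) ⟩
      u l + - 1# * v l ∎

open import Defs
open IteratedDifference ℝ-commutativeRing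

private
  module ℝᴿ = CommutativeRing ℝ-commutativeRing

module _ (t : ℕ → ℕ → ℝ) (c : ℝ) (t₀≈c : ∀ i → t i 0 ≈ c)
  (pascal : ∀ i j → 2 ≤ i → 1 ≤ j → j ≤ i ∸ 1 → t i j ≈ t (i ∸ 1) (j ∸ 1) + t (i ∸ 1) j)
  where

  open import Algebra.Properties.Ring ℝᴿ.ring using (-0#≈0#)

  diff-t : ∀ j i → j ≤ i → diff (suc j) (λ n → t n j) i ≈ 0#
  diff-t zero i _ =
    ℝᴿ.trans (ℝᴿ.+-cong (t₀≈c i) (ℝᴿ.-‿cong (t₀≈c (suc i)))) (ℝᴿ.-‿inverseʳ c)
  diff-t (suc j) i j<i = ℝᴿ.trans
    (diff-antidifference {f = λ n → t n (suc j)} {λ n → t n j}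
      -- In row `suc n` the rule reaches column `suc j` exactly when `suc j ≤ n`, hence the starting
      -- row `suc j`.
      (λ n j<n → pascal (suc n) (suc j) (s≤s (ℕ.≤-trans (s≤s z≤n) j<n)) (s≤s z≤n) j<n)
      (suc j) i j<i)
    (ℝᴿ.trans (ℝᴿ.-‿cong (diff-t j i (ℕ.<⇒≤ j<i))) -0#≈0#)

  -- Induction on `k` with `j` and `i` free, since the recursion also visits column `suc j` and the
  -- previous row.
  diff-h : ∀ k j i → j ℕ.+ k ≤ i → diff (suc (j ℕ.+ k)) (λ n → h t n j k) i ≈ 0#
  diff-h zero    j i p rewrite ℕ.+-identityʳ j = diff-t j i p
  diff-h (suc k) j i p rewrite ℕ.+-suc j k with i | p
  ... | suc i | s≤s q = begin
    diff d (λ n → shifted n + same n + next n) (suc i)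
      ≈⟨ diff-distrib-+ d (λ n → shifted n + same n) next (suc i) ⟩
    diff d (λ n → shifted n + same n) (suc i) + diff d next (suc i)
      ≈⟨ ℝᴿ.+-congʳ (diff-distrib-+ d shifted same (suc i)) ⟩
    diff d shifted (suc i) + diff d same (suc i) + diff d next (suc i)
      -- `shifted (suc n)` computes to `same n`; the truncation at row 0 is not met because the
      -- bound forces a positive row.
      ≡⟨ ≡.cong (λ x → x + diff d same (suc i) + diff d next (suc i)) (diff-∘suc d shifted i) ⟨
    diff d same i + diff d same (suc i) + diff d next (suc i)
      -- `d` is exactly the order for column `suc j`, and one more than the order for column `j`.
      ≈⟨ ℝᴿ.+-cong (ℝᴿ.+-cong (same-zero i q) (same-zero (suc i) (ℕ.m≤n⇒m≤1+n q)))
                  (diff-h k (suc j) (suc i) (s≤s q)) ⟩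
    0# + 0# + 0#  ≈⟨ ℝᴿ.trans (ℝᴿ.+-identityʳ _) (ℝᴿ.+-identityʳ _) ⟩
    0#            ∎
    where
    open import Relation.Binary.Reasoning.Setoid ℝᴿ.setoid
    d : ℕ
    d = suc (suc (j ℕ.+ k))
    shifted same next : ℕ → ℝ
    shifted n = h t (n ∸ 1) j k
    same    n = h t n j k
    next    n = h t n (suc j) k
    same-zero : ∀ n → j ℕ.+ k ≤ n → diff d same n ≈ 0#
    same-zero n r = diff-suc-zero (suc (j ℕ.+ k)) same n
      (diff-h k j n r) (diff-h k j (suc n) (ℕ.m≤n⇒m≤1+n r))

theorem6 : (t : ℕ → ℕ → ℝ) (c : ℝ) →
    (∀ i → t i 0 ≈ c) →
    (∀ i j → 2 ≤ i → 1 ≤ j → j ≤ i ∸ 1 → t i j ≈ t (i ∸ 1) (j ∸ 1) + t (i ∸ 1) j) →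
    ∀ j k → let m = j ℕ.+ k ℕ.+ 1 in
    ∀ i → j ℕ.+ k ≤ i →
    ∑[ l ≤ m ] ((- 1#) ^ toℕ l * fromℕ (m C toℕ l) * h t (i ℕ.+ toℕ l) j k) ≈ 0#
theorem6 t c t₀≈c pascal j k i j+k≤i = ℝᴿ.trans
  -- With `N = m` the sum ends at `l = m`, as required.
  (∑-coeff≈diff m m (λ n → h t n j k) i ℕ.≤-refl)
  (≡.subst (λ d → diff d (λ n → h t n j k) i ≈ 0#) (ℕ.+-comm 1 (j ℕ.+ k))
    (diff-h t c t₀≈c pascal k j i j+k≤i))
  where
  m : ℕ
  m = j ℕ.+ k ℕ.+ 1
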